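{- Let $G$ be a simple connected undirected graph with $n$ vertices, and let $\rho_1(G),\dots,\rho_n(G)$ be the eigenvalues, counted with multiplicity, of its resistance distance matrix. Then $$\mathcal{K}f(G)\le\frac{\sqrt{n(n-1)\sum_{i=1}^n\rho_i(G)^2}}{2}.$$
   Context: For a connected graph $G$ with vertices $v_1,\dots,v_n$, Laplacian matrix $L$ (degree matrix minus adjacency matrix) and Moore-Penrose inverse $L^\dagger=(l^\dagger_{ij})$, the resistance distance is $r_{ij}=l^\dagger_{ii}+l^\dagger_{jj}-2l^\dagger_{ij}$, and the resistance distance matrix is $R(G)=(r_{ij})_{n\times n}$. The Kirchhoff index is $\mathcal{K}f(G)=\sum_{i<j}r_{ij}$. -}

module Defs where

open import Level using (Level; _⊔_; 0ℓ) renaming (suc to lsuc)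
open import Algebra.Bundles using (RawRing)
open import Algebra.Apartness.Bundles using (HeytingField; HeytingCommutativeRing)
import Algebra.Bundles
import Algebra.Definitions.RawSemiring
open import Data.Bool.Base using (if_then_else_)
open import Data.Fin.Base using (Fin; zero; suc; toℕ; punchIn)
open import Data.Fin.Properties using (_≟_; _<?_)
open import Data.List.Base using (List; []; _∷_; map; filter; length; allFin)
open import Data.Nat.Base as ℕ using (ℕ; zero; suc)
open import Data.Product.Base using (∃-syntax; _×_; _,_; proj₁)
open import Data.Sum.Base using (_⊎_; inj₂)
open import Data.Vec.Functional using (Vector; transpose)
open import Function.Bundles using (_⇔_; Equivalence)
open import Relation.Binary.Core using (Rel)
open import Relation.Binary.Definitions using (Decidable; Irreflexive; Symmetric)
open import Relation.Binary.PropositionalEquality.Core using (_≡_)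
open import Relation.Binary.Structures using (IsStrictPartialOrder)
open import Relation.Binary.Construct.Closure.ReflexiveTransitive using (Star)
open import Relation.Nullary.Decidable.Core using (does)
open import Relation.Nullary.Negation.Core using (¬_)

private
  variable
    c ℓ ℓ₁ ℓ₂ : Level
    n : ℕ

-- The real numbers, axiomatised as a Cauchy-complete Archimedean ordered field.
-- The order is not assumed decidable, so the axioms hold both of the classical
-- reals and of Bishop's constructive reals.

record Reals c ℓ₁ ℓ₂ : Set (lsuc (c ⊔ ℓ₁ ⊔ ℓ₂)) where
  infix 4 _<_ _≤_
  field
    heytingField : HeytingField c ℓ₁ ℓ₂

  open HeytingField heytingField public
  open HeytingCommutativeRing heytingCommutativeRing public using (commutativeRing)
  open Algebra.Bundles.CommutativeRing commutativeRing public using (rawRing)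
  open Algebra.Definitions.RawSemiring (RawRing.rawSemiring rawRing) public
    using (sum) renaming (_×_ to _·_)

  field
    _<_                  : Rel Carrier ℓ₂
    <-isStrictPartialOrder : IsStrictPartialOrder _≈_ _<_
    #⇔<⊎>                : ∀ {x y} → x # y ⇔ (x < y ⊎ y < x)
    <-cotrans            : ∀ {x y} → x < y → ∀ z → x < z ⊎ z < y
    +-monoˡ-<            : ∀ {x y} z → x < y → x + z < y + z
    *-pos                : ∀ {x y} → 0# < x → 0# < y → 0# < x * y
    0<1                  : 0# < 1#

  _≤_ : Rel Carrier ℓ₂
  x ≤ y = ¬ (y < x)

  fromℕ : ℕ → Carrier
  fromℕ k = k · 1#

  IsCauchy : (ℕ → Carrier) → Set (c ⊔ ℓ₂)
  IsCauchy a = ∀ ε → 0# < ε →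
    ∃[ N ] (∀ j k → N ℕ.≤ j → N ℕ.≤ k → a j - a k < ε)

  _⟶_ : (ℕ → Carrier) → Carrier → Set (c ⊔ ℓ₂)
  a ⟶ l = ∀ ε → 0# < ε →
    ∃[ N ] (∀ k → N ℕ.≤ k → a k - l < ε × l - a k < ε)

  field
    archimedean : ∀ x → ∃[ k ] x < fromℕ k
    complete    : ∀ a → IsCauchy a → ∃[ l ] a ⟶ l

    -- As usual the square root is a total function; its value at negative
    -- arguments is left unspecified.
    √           : Carrier → Carrier
    √-nonneg    : ∀ {x} → 0# ≤ x → 0# ≤ √ x
    √-square    : ∀ {x} → 0# ≤ x → √ x * √ x ≈ x

  open IsStrictPartialOrder <-isStrictPartialOrder public
    using (<-respʳ-≈) renaming (trans to <-trans)

  0<2 : 0# < fromℕ 2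
  0<2 = <-trans 0<1 (<-respʳ-≈ (+-congˡ (sym (+-identityʳ 1#)))
          (<-respˡ (+-monoˡ-< 1# 0<1)))
    where
    <-respˡ : ∀ {y} → 0# + 1# < y → 1# < y
    <-respˡ = IsStrictPartialOrder.<-respˡ-≈ <-isStrictPartialOrder (+-identityˡ 1#)

  2#0 : fromℕ 2 # 0#
  2#0 = Equivalence.from #⇔<⊎> (inj₂ 0<2)

  -- #⇒invertible inverts the difference fromℕ 2 - 0#, which is equal to 2.
  ½ : Carrier
  ½ = proj₁ (#⇒invertible 2#0)

  infixl 7 _/2
  _/2 : Carrier → Carrier
  x /2 = x * ½

record SimpleGraph (n : ℕ) : Set₁ where
  field
    Adj    : Rel (Fin n) 0ℓ
    adj?   : Decidable Adj
    symm   : Symmetric Adj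
    irrefl : Irreflexive _≡_ Adj

  degree : Fin n → ℕ
  degree i = length (filter (adj? i) (allFin n))

  -- At least one vertex, and a walk between any two vertices.
  Connected : Set
  Connected = Fin n × (∀ u v → Star Adj u v)

Matrix : Set c → ℕ → Set c
Matrix A n = Vector (Vector A n) n

module Determinant (R : RawRing c ℓ) where
  open RawRing R
  open Algebra.Definitions.RawSemiring rawSemiring using (sum; _^_)

  -- Laplace expansion along the first row.
  det : Matrix Carrier n → Carrier
  det {zero}  A = 1#
  det {suc n} A = sum λ j →
    (- 1#) ^ toℕ j * (A zero j * det (λ i k → A (suc i) (punchIn j k)))

-- Univariate polynomials as lists of coefficients, constant term first.  Lists
-- may have trailing zeros, so equality compares coefficients.

module Polynomial (R : RawRing c ℓ) where
  open RawRing R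

  Poly : Set c
  Poly = List Carrier

  coeff : Poly → ℕ → Carrier
  coeff []      k       = 0#
  coeff (a ∷ p) zero    = a
  coeff (a ∷ p) (suc k) = coeff p k

  _≈ᵖ_ : Rel Poly ℓ
  p ≈ᵖ q = ∀ k → coeff p k ≈ coeff q k

  _+ᵖ_ : Poly → Poly → Poly
  []      +ᵖ q       = q
  (a ∷ p) +ᵖ []      = a ∷ p
  (a ∷ p) +ᵖ (b ∷ q) = (a + b) ∷ (p +ᵖ q)

  _*ᵖ_ : Poly → Poly → Poly
  []      *ᵖ q = []
  (a ∷ p) *ᵖ q = map (a *_) q +ᵖ (0# ∷ (p *ᵖ q))

  C : Carrier → Poly
  C a = a ∷ []

  X : Poly
  X = 0# ∷ 1# ∷ []

  polyRawRing : RawRing c ℓ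
  polyRawRing = record
    { Carrier = Poly
    ; _≈_     = _≈ᵖ_
    ; _+_     = _+ᵖ_
    ; _*_     = _*ᵖ_
    ; -_      = map -_
    ; 0#      = []
    ; 1#      = C 1#
    }

module RealMatrices (ℝ : Reals c ℓ₁ ℓ₂) where
  open Reals ℝ public
  open Polynomial rawRing public
  private
    module P = RawRing polyRawRing
    module Σᵖ = Algebra.Definitions.RawSemiring P.rawSemiring

  infix  4 _≋_
  infixl 7 _⊗_

  _≋_ : Rel (Matrix Carrier n) ℓ₁
  A ≋ B = ∀ i j → A i j ≈ B i j

  _⊗_ : Matrix Carrier n → Matrix Carrier n → Matrix Carrier n
  (A ⊗ B) i j = sum λ k → A i k * B k j

  charPoly : Matrix Carrier n → Poly
  charPoly A = Determinant.det polyRawRing λ i j →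
    (if does (i ≟ j) then X else P.0#) P.+ (P.- C (A i j))

  -- ρ lists the eigenvalues of A with algebraic multiplicity:
  -- det (X I − A) = ∏ᵢ (X − ρᵢ) as polynomials.
  AreEigenvalues : Matrix Carrier n → Vector Carrier n → Set ℓ₁
  AreEigenvalues A ρ = charPoly A ≈ᵖ Σᵖ.product λ i → X P.+ (P.- C (ρ i))

  record IsMoorePenroseInverse (A A† : Matrix Carrier n) : Set ℓ₁ where
    field
      AA†A≋A    : A ⊗ A† ⊗ A ≋ A
      A†AA†≋A†  : A† ⊗ A ⊗ A† ≋ A†
      AA†-symm  : transpose (A ⊗ A†) ≋ A ⊗ A†
      A†A-symm  : transpose (A† ⊗ A) ≋ A† ⊗ A

  module _ (G : SimpleGraph n) where
    open SimpleGraph G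

    adjacency : Matrix Carrier n
    adjacency i j = if does (adj? i j) then 1# else 0#

    degreeMatrix : Matrix Carrier n
    degreeMatrix i j = if does (i ≟ j) then fromℕ (degree i) else 0#

    laplacian : Matrix Carrier n
    laplacian i j = degreeMatrix i j - adjacency i j

  resistanceMatrix : (L† : Matrix Carrier n) → Matrix Carrier n
  resistanceMatrix L† i j = (L† i i + L† j j) - fromℕ 2 * L† i j

  kirchhoffIndex : (L† : Matrix Carrier n) → Carrier
  kirchhoffIndex L† = sum λ i → sum λ j →
    if does (i <? j) then resistanceMatrix L† i j else 0#

{-# OPTIONS --safe #-}
module Submission where

-- Write r for the resistance matrix.  It is symmetric with zero diagonal.  The
-- symmetry is inherited from the Laplacian L: the Moore-Penrose inverse of a
-- symmetric matrix is symmetric (moorePenrose-symmetric).  Hence 2 Kf is the sum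
-- of all entries of r (kirchhoff-double), and the Cauchy-Schwarz inequality, used
-- once in each row on the n - 1 entries off the diagonal and once on the n row
-- sums, gives (2 Kf)² ≤ n (n - 1) ∑ r i j ² (cauchySchwarz-hollow).  Since r is
-- symmetric, ∑ r i j ² is the trace of r r, and the latter is ∑ ρ i ²
-- (sum-eigenvalue-squares).  Taking square roots and halving gives the bound.
--
-- The eigenvalues are given only through the characteristic polynomial, so the
-- trace of A A is read off from the three leading coefficients of
-- det (X I - A) = ∏ (X - ρ i).  Let d₁ and d₂ be the coefficients of X ^ (n - 1)
-- and X ^ (n - 2).  Newton's identity says that d₁ ² - 2 d₂ is ∑ ρ i ² on the
-- product side (rootProduct-newton), and it is the trace of A A on the
-- determinant side (pencil-newton).  Both are proved by induction on n, the
-- second from the Laplace expansion along the first row: the term of a column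
-- other than the first affects d₂ only through the leading coefficient of a
-- minor, which is a single signed entry of the matrix (pencil₁-cofactor).  To
-- index coefficients from the top, a polynomial of degree at most m is compared
-- with its reversal, which turns det (X I - A) into det (I - t A).
--
-- The order is constructive: x ≤ y means that y < x is impossible.  All
-- inequalities are therefore derived by refuting strict ones, and squares are
-- nonnegative because the apartness relation is tight.

open import Defs
open import Level using (_⊔_)
open import Algebra.Bundles using (CommutativeRing; RawRing)
import Algebra.Definitions.RawSemiring
import Algebra.Properties.Ring
import Algebra.Properties.Semiring.Sum
import Algebra.Solver.Ring.NaturalCoefficients.Default
import Relation.Binary.Reasoning.Setoid
open import Data.Bool.Base using (if_then_else_; true; false)
open import Data.Fin.Base as Fin using (Fin; zero; suc; toℕ; punchIn)
open import Data.Fin.Properties using (_≟_; _<?_; <-cmp)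
open import Data.List.Base using (List; []; _∷_; map)
open import Data.Nat.Base as ℕ using (ℕ; zero; suc; s≤s)
import Data.Nat.Properties as ℕ
open import Data.Product.Base using (∃-syntax; _×_; _,_; proj₁; proj₂)
open import Data.Sum.Base using (inj₁; inj₂; [_,_]′)
open import Data.Vec.Functional using (Vector; removeAt; transpose)
open import Function.Bundles using (Equivalence)
open import Relation.Binary.Bundles using (Setoid)
open import Relation.Binary.Definitions using (tri<; tri≈; tri>)
open import Relation.Binary.PropositionalEquality.Core as ≡ using (_≡_)
open import Relation.Binary.Structures using (IsStrictPartialOrder)
open import Relation.Nullary.Decidable using (does; yes; no; dec-true; dec-false)
open import Relation.Nullary.Negation.Core using (¬_; contradiction)

-- The sum of the squared eigenvalues, over a commutative ring
module CharacteristicPolynomial {c ℓ} (R : CommutativeRing c ℓ) where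
  open CommutativeRing R hiding (zero)
  open Polynomial rawRing
  open Algebra.Definitions.RawSemiring (RawRing.rawSemiring rawRing) using (_^_)
  open Algebra.Properties.Ring ring using (-1*x≈-x; -‿involutive; +-cancelʳ)
  open Algebra.Properties.Semiring.Sum semiring
  open Algebra.Solver.Ring.NaturalCoefficients.Default commutativeSemiring
  open Relation.Binary.Reasoning.Setoid setoid
  private
    module P = RawRing polyRawRing
    module Σᵖ = Algebra.Definitions.RawSemiring P.rawSemiring

  sum-zero : ∀ {n} {f : Vector Carrier n} → (∀ i → f i ≈ 0#) → sum f ≈ 0#
  sum-zero {n} f≈0 = trans (sum-cong-≋ f≈0) (sum-replicate-zero n)

  -- The coefficients of X f, where f is given by its coefficients.
  shift : (ℕ → Carrier) → ℕ → Carrier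
  shift f zero    = 0#
  shift f (suc k) = f k

  -- The coefficients of the constant polynomial 1.
  one : ℕ → Carrier
  one zero    = 1#
  one (suc k) = 0#

  coeff-+ : ∀ p q k → coeff (p +ᵖ q) k ≈ coeff p k + coeff q k
  coeff-+ []      q       k       = sym (+-identityˡ _)
  coeff-+ (a ∷ p) []      k       = sym (+-identityʳ _)
  coeff-+ (a ∷ p) (b ∷ q) zero    = refl
  coeff-+ (a ∷ p) (b ∷ q) (suc k) = coeff-+ p q k

  coeff-scale : ∀ a q k → coeff (map (a *_) q) k ≈ a * coeff q k
  coeff-scale a []      k       = sym (zeroʳ a)
  coeff-scale a (b ∷ q) zero    = refl
  coeff-scale a (b ∷ q) (suc k) = coeff-scale a q k

  coeff-[0] : ∀ k → coeff (0# ∷ []) k ≈ 0#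
  coeff-[0] zero    = refl
  coeff-[0] (suc k) = refl

  -- Linear p b u: p has one or two listed coefficients and equals b + u X.
  data Linear : Poly → Carrier → Carrier → Set (c ⊔ ℓ) where
    constant : ∀ {a b u} → a ≈ b → 0# ≈ u → Linear (a ∷ []) b u
    linear   : ∀ {a d b u} → a ≈ b → d ≈ u → Linear (a ∷ d ∷ []) b u

  coeff-linear-* : ∀ {p b u} → Linear p b u → ∀ q k →
                   coeff (p *ᵖ q) k ≈ b * coeff q k + u * shift (coeff q) k
  coeff-linear-* {_} {b} {u} (constant {a} a≈b 0≈u) q k = begin
    coeff (map (a *_) q +ᵖ (0# ∷ [])) k     ≈⟨ coeff-+ (map (a *_) q) _ k ⟩
    coeff (map (a *_) q) k + coeff (0# ∷ []) k
      ≈⟨ +-cong (trans (coeff-scale a q k) (*-congʳ a≈b)) (coeff-[0] k) ⟩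
    b * coeff q k + 0#                      ≈⟨ +-congˡ (zeroˡ _) ⟨
    b * coeff q k + 0# * shift (coeff q) k  ≈⟨ +-congˡ (*-congʳ 0≈u) ⟩
    b * coeff q k + u * shift (coeff q) k   ∎
  coeff-linear-* {_} {b} {u} (linear {a} {d} a≈b d≈u) q k =
    trans (coeff-+ (map (a *_) q) _ k)
      (+-cong (trans (coeff-scale a q k) (*-congʳ a≈b)) (upper k))
    where
    upper : ∀ k → coeff (0# ∷ (map (d *_) q +ᵖ (0# ∷ []))) k ≈ u * shift (coeff q) k
    upper zero    = sym (zeroʳ u)
    upper (suc k) = begin
      coeff (map (d *_) q +ᵖ (0# ∷ [])) k         ≈⟨ coeff-+ (map (d *_) q) _ k ⟩
      coeff (map (d *_) q) k + coeff (0# ∷ []) k  ≈⟨ +-cong (coeff-scale d q k) (coeff-[0] k) ⟩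
      d * coeff q k + 0#                          ≈⟨ +-identityʳ _ ⟩
      d * coeff q k                               ≈⟨ *-congʳ d≈u ⟩
      u * coeff q k                               ∎

  -- p has degree at most m, and f is the coefficient sequence of t ^ m p (1 / t).
  -- The condition k + l = m replaces a truncated subtraction, and both sequences
  -- vanish above m.
  record Reversal (m : ℕ) (p : Poly) (f : ℕ → Carrier) : Set ℓ where
    field
      coeff≈  : ∀ k l → k ℕ.+ l ≡ m → coeff p l ≈ f k
      coeff≈0 : ∀ l → m ℕ.< l → coeff p l ≈ 0#
      rev≈0   : ∀ k → m ℕ.< k → f k ≈ 0#
  open Reversal

  reversal-unique : ∀ {m p q f g} → Reversal m p f → Reversal m q g → p ≈ᵖ q → ∀ k → f k ≈ g k
  reversal-unique {m} r s p≈q k with k ℕ.≤? m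
  ... | yes k≤m = trans (sym (coeff≈ r k (m ℕ.∸ k) (ℕ.m+[n∸m]≡n k≤m)))
                    (trans (p≈q _) (coeff≈ s k (m ℕ.∸ k) (ℕ.m+[n∸m]≡n k≤m)))
  ... | no  k≰m = trans (rev≈0 r k (ℕ.≰⇒> k≰m)) (sym (rev≈0 s k (ℕ.≰⇒> k≰m)))

  reversal-1 : Reversal 0 (C 1#) one
  reversal-1 .coeff≈ zero zero ≡.refl = refl
  reversal-1 .coeff≈0 (suc l) _ = refl
  reversal-1 .rev≈0 (suc k) _ = refl

  reversal-+ : ∀ {m p q f g} → Reversal m p f → Reversal m q g →
               Reversal m (p +ᵖ q) (λ k → f k + g k)
  reversal-+ {p = p} {q} r s .coeff≈ k l e =
    trans (coeff-+ p q l) (+-cong (coeff≈ r k l e) (coeff≈ s k l e))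
  reversal-+ {p = p} {q} r s .coeff≈0 l m<l =
    trans (coeff-+ p q l) (trans (+-cong (coeff≈0 r l m<l) (coeff≈0 s l m<l)) (+-identityʳ 0#))
  reversal-+ r s .rev≈0 k m<k =
    trans (+-cong (rev≈0 r k m<k) (rev≈0 s k m<k)) (+-identityʳ 0#)

  reversal-sum : ∀ {m n} {p : Vector Poly n} {f : Fin n → ℕ → Carrier} →
                 (∀ j → Reversal m (p j) (f j)) →
                 Reversal m (Σᵖ.sum p) (λ k → sum (λ j → f j k))
  reversal-sum {n = zero}  r = record
    { coeff≈ = λ _ _ _ → refl ; coeff≈0 = λ _ _ → refl ; rev≈0 = λ _ _ → refl }
  reversal-sum {n = suc n} r = reversal-+ (r zero) (reversal-sum (λ j → r (suc j)))

  private
    lin0 : ∀ {x y} a b → x ≈ 0# → y ≈ 0# → a * x + b * y ≈ 0#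
    lin0 a b x≈0 y≈0 = trans (+-cong (trans (*-congˡ x≈0) (zeroʳ a)) (trans (*-congˡ y≈0) (zeroʳ b)))
                         (+-identityʳ 0#)

    shift≈0 : ∀ {m f} → (∀ k → m ℕ.< k → f k ≈ 0#) → ∀ k → suc m ℕ.< k → shift f k ≈ 0#
    shift≈0 f≈0 (suc k) (s≤s m<k) = f≈0 k m<k

  reversal-linear-* : ∀ {m p b u q f} → Linear p b u → Reversal m q f →
                      Reversal (suc m) (p *ᵖ q) (λ k → u * f k + b * shift f k)
  reversal-linear-* {m} {p} {b} {u} {q} {f} lin r .coeff≈ k l e = begin
    coeff (p *ᵖ q) l                       ≈⟨ coeff-linear-* lin q l ⟩
    b * coeff q l + u * shift (coeff q) l  ≈⟨ +-comm _ _ ⟩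
    u * shift (coeff q) l + b * coeff q l  ≈⟨ +-cong (*-congˡ (left k l e)) (*-congˡ (right k l e)) ⟩
    u * f k + b * shift f k                ∎
    where
    -- At the ends, where l or k is 0, both sides vanish by the degree bounds.
    left : ∀ k l → k ℕ.+ l ≡ suc m → shift (coeff q) l ≈ f k
    left k zero    e = sym (rev≈0 r k (ℕ.≤-reflexive (≡.sym (≡.trans (≡.sym (ℕ.+-identityʳ k)) e))))
    left k (suc l) e = coeff≈ r k l (ℕ.suc-injective (≡.trans (≡.sym (ℕ.+-suc k l)) e))
    right : ∀ k l → k ℕ.+ l ≡ suc m → coeff q l ≈ shift f k
    right zero    l e = coeff≈0 r l (ℕ.≤-reflexive (≡.sym e))
    right (suc k) l e = coeff≈ r k l (ℕ.suc-injective e)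
  reversal-linear-* {q = q} lin r .coeff≈0 l m<l =
    trans (coeff-linear-* lin q l)
      (lin0 _ _ (coeff≈0 r l (ℕ.<-trans (ℕ.n<1+n _) m<l)) (shift≈0 (coeff≈0 r) l m<l))
  reversal-linear-* lin r .rev≈0 k m<k =
    lin0 _ _ (rev≈0 r k (ℕ.<-trans (ℕ.n<1+n _) m<k)) (shift≈0 (rev≈0 r) k m<k)

  -- Multiplication by a constant, without raising the degree bound.
  reversal-scale : ∀ {m p a q f} → Linear p a 0# → Reversal m q f →
                   Reversal m (p *ᵖ q) (λ k → a * f k)
  reversal-scale {m} {p} {a} {q} {f} lin r = record
    { coeff≈  = λ k l e → trans (scale l) (*-congˡ (coeff≈ r k l e))
    ; coeff≈0 = λ l m<l → trans (scale l) (trans (*-congˡ (coeff≈0 r l m<l)) (zeroʳ a))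
    ; rev≈0   = λ k m<k → trans (*-congˡ (rev≈0 r k m<k)) (zeroʳ a)
    }
    where
    scale : ∀ l → coeff (p *ᵖ q) l ≈ a * coeff q l
    scale l = trans (coeff-linear-* lin q l) (trans (+-congˡ (zeroˡ _)) (+-identityʳ _))

  sign : ℕ → Carrier
  sign k = (- 1#) ^ k

  sign-square : ∀ k → sign k * sign k ≈ 1#
  sign-square zero    = *-identityˡ 1#
  sign-square (suc k) = begin
    - 1# * sign k * (- 1# * sign k)
      ≈⟨ solve 2 (λ x s → x :* s :* (x :* s) := x :* x :* (s :* s)) refl (- 1#) (sign k) ⟩
    - 1# * - 1# * (sign k * sign k)  ≈⟨ *-cong (-1*x≈-x _) (sign-square k) ⟩
    - (- 1#) * 1#                    ≈⟨ *-identityʳ _ ⟩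
    - (- 1#)                         ≈⟨ -‿involutive 1# ⟩
    1#                               ∎

  -- Powers of the polynomial -1 are singleton lists.
  sign-poly : ∀ k → ∃[ a ] ((P.- P.1#) Σᵖ.^ k ≡ a ∷ []) × (a ≈ sign k)
  sign-poly zero = 1# , ≡.refl , refl
  sign-poly (suc k) with (P.- P.1#) Σᵖ.^ k | sign-poly k
  ... | _ | a , ≡.refl , a≈s = - 1# * a + 0# , ≡.refl , trans (+-identityʳ _) (*-congˡ a≈s)

  sign-linear : ∀ k → Linear ((P.- P.1#) Σᵖ.^ k) (sign k) 0#
  sign-linear k with (P.- P.1#) Σᵖ.^ k | sign-poly k
  ... | _ | a , ≡.refl , a≈s = constant a≈s refl

  -- The first row and the column j are deleted.
  minor : ∀ {m} → Matrix Carrier (suc m) → Fin (suc m) → Matrix Carrier m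
  minor M j i k = M (suc i) (punchIn j k)

  -- pencil U B k is the coefficient of t ^ k in det (U + t B), equally that of
  -- X ^ (m - k) in det (X U + B), computed by expansion along the first row.
  -- Row 0 contributes either its constant entry, leaving all of t ^ k to the
  -- minor, or its entry in t, leaving t ^ (k - 1).
  pencil : ∀ {m} → Matrix Carrier m → Matrix Carrier m → ℕ → Carrier
  pencilTerm : ∀ {m} → Matrix Carrier (suc m) → Matrix Carrier (suc m) →
               ℕ → Fin (suc m) → Carrier

  pencil {zero}  U B   = one
  pencil {suc m} U B k = sum (pencilTerm U B k)

  pencilTerm U B k j = sign (toℕ j) *
    (U zero j * pencil (minor U j) (minor B j) k +
     B zero j * shift (pencil (minor U j) (minor B j)) k)

  -- For M = X U + B, with Laplace expansion on both sides.
  reversal-det : ∀ {m} {M : Matrix Poly m} {U B} → (∀ i j → Linear (M i j) (B i j) (U i j)) →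
                 Reversal m (Determinant.det polyRawRing M) (pencil U B)
  reversal-det {zero}  lin = reversal-1
  reversal-det {suc m} lin = reversal-sum λ j →
    reversal-scale (sign-linear (toℕ j))
      (reversal-linear-* (lin zero j) (reversal-det (λ i k → lin (suc i) (punchIn j k))))

  -- The identity matrix.
  δ : ∀ {m} → Fin m → Fin m → Carrier
  δ i j = if does (i ≟ j) then 1# else 0#

  private
    *-zeroˡ : ∀ {x y} → x ≈ 0# → x * y ≈ 0#
    *-zeroˡ x≈0 = trans (*-congʳ x≈0) (zeroˡ _)

    *-zeroʳ : ∀ {x y} → y ≈ 0# → x * y ≈ 0#
    *-zeroʳ y≈0 = trans (*-congˡ y≈0) (zeroʳ _)

    term≈0 : ∀ {s x y} → x ≈ 0# → y ≈ 0# → s * (x + y) ≈ 0#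
    term≈0 x≈0 y≈0 = *-zeroʳ (trans (+-cong x≈0 y≈0) (+-identityʳ 0#))

  -- A determinant with zero first column vanishes.  Minors that delete another
  -- column inherit the zero column.
  pencil₀-zeroColumn : ∀ {m} (U B : Matrix Carrier (suc m)) →
                       (∀ i → U i zero ≈ 0#) → pencil U B 0 ≈ 0#
  pencil₀-zeroColumn {m} U B U≈0 = sum-zero {suc m} (vanish {m} U B U≈0)
    where
    vanish : ∀ {m} (U B : Matrix Carrier (suc m)) → (∀ i → U i zero ≈ 0#) →
             ∀ j → pencilTerm U B 0 j ≈ 0#
    vanish         U B U≈0 zero    = term≈0 (*-zeroˡ (U≈0 zero)) (zeroʳ _)
    vanish {suc m} U B U≈0 (suc j) = term≈0
      (*-zeroʳ (pencil₀-zeroColumn (minor U (suc j)) (minor B (suc j)) (λ i → U≈0 (suc i))))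
      (zeroʳ _)

  pencil₀-identity : ∀ {m} (U B : Matrix Carrier m) → (∀ i j → U i j ≈ δ i j) → pencil U B 0 ≈ 1#
  pencil₀-identity {zero}  U B U≈I = refl
  pencil₀-identity {suc m} U B U≈I = begin
    pencil U B 0
      ≈⟨ +-cong (*-congˡ (+-cong
                  (*-cong (U≈I zero zero)
                    (pencil₀-identity (minor U zero) (minor B zero) λ i j → U≈I (suc i) (suc j)))
                  (zeroʳ _)))
                (sum-zero {m} λ j → term≈0 (*-zeroˡ (U≈I zero (suc j))) (zeroʳ _)) ⟩
    1# * (1# * 1# + 0#) + 0#
      ≈⟨ solve 0 (con 1 :* (con 1 :* con 1 :+ con 0) :+ con 0 := con 1) refl ⟩
    1# ∎

  -- Deleting a column other than the first keeps the first column of U, which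
  -- vanishes below row 0, so the minor has no constant coefficient.
  pencilTerm₁-vanish : ∀ {m} (U B : Matrix Carrier (suc m)) → (∀ i → U (suc i) zero ≈ 0#) →
                       ∀ j → U zero (suc j) ≈ 0# → pencilTerm U B 1 (suc j) ≈ 0#
  pencilTerm₁-vanish {suc m} U B U≈0 j U₀ⱼ≈0 = term≈0 (*-zeroˡ U₀ⱼ≈0)
    (*-zeroʳ (pencil₀-zeroColumn (minor U (suc j)) (minor B (suc j)) U≈0))

  -- Here U is the identity with column j deleted and a zero column put in
  -- front.  Modulo t ^ 2, det (U + t B) is t times the determinant of that
  -- matrix with the first column of B in place of the zero column.
  pencil₁-cofactor : ∀ {m} (U B : Matrix Carrier (suc m)) (j : Fin (suc m)) →
    (∀ i → U i zero ≈ 0#) → (∀ i k → U i (suc k) ≈ δ i (punchIn j k)) →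
    pencil U B 1 ≈ sign (toℕ j) * B j zero
  pencil₁-cofactor {m} U B zero U≈0 U≈I = begin
    pencil U B 1
      ≈⟨ +-cong (*-congˡ (+-cong (*-zeroˡ (U≈0 zero))
                  (*-congˡ (pencil₀-identity (minor U zero) (minor B zero) λ i j → U≈I (suc i) j))))
                (sum-zero {m} λ j → pencilTerm₁-vanish U B (λ i → U≈0 (suc i)) j (U≈I zero j)) ⟩
    1# * (0# + B zero zero * 1#) + 0#
      ≈⟨ solve 1 (λ b → con 1 :* (con 0 :+ b :* con 1) :+ con 0 := con 1 :* b) refl (B zero zero) ⟩
    1# * B zero zero ∎
  -- Row 0 of U has its only 1 in column 1, so the term of column 1 alone survives.
  pencil₁-cofactor {suc m} U B (suc j) U≈0 U≈I = begin
    pencil U B 1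
      ≈⟨ +-cong
           (term≈0 (*-zeroˡ (U≈0 zero))
             (*-zeroʳ (pencil₀-zeroColumn (minor U zero) (minor B zero) λ i → U≈I (suc i) zero)))
           (+-cong
             (*-congˡ (+-cong
               (*-cong (U≈I zero zero)
                 (pencil₁-cofactor U₁ B₁ j (λ i → U≈0 (suc i)) (λ i k → U≈I (suc i) (suc k))))
               (*-zeroʳ (pencil₀-zeroColumn U₁ B₁ λ i → U≈0 (suc i)))))
             (sum-zero {m} λ k →
               pencilTerm₁-vanish U B (λ i → U≈0 (suc i)) (suc k) (U≈I zero (suc k)))) ⟩
    0# + (- 1# * 1# * (1# * (sign (toℕ j) * B (suc j) zero) + 0#) + 0#)
      ≈⟨ solve 3 (λ t s b → con 0 :+ (t :* con 1 :* (con 1 :* (s :* b) :+ con 0) :+ con 0) := t :* s :* b)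
           refl (- 1#) (sign (toℕ j)) (B (suc j) zero) ⟩
    sign (suc (toℕ j)) * B (suc j) zero ∎
    where
    U₁ B₁ : Matrix Carrier (suc m)
    U₁ = minor U (suc zero)
    B₁ = minor B (suc zero)

  -- The trace of B B.
  traceSquare : ∀ {m} → Matrix Carrier m → Carrier
  traceSquare B = sum λ i → sum λ j → B i j * B j i

  traceSquare-suc : ∀ {m} (B : Matrix Carrier (suc m)) →
    traceSquare B ≈ B zero zero * B zero zero + (sum λ k → B zero (suc k) * B (suc k) zero)
      + ((sum λ k → B zero (suc k) * B (suc k) zero) + traceSquare (minor B zero))
  traceSquare-suc {m} B = +-congˡ (trans (∑-distrib-+ {m} _ _)
    (+-congʳ (sum-cong-≋ {m} λ k → *-comm _ _)))

  -- The coefficient of t in det (I + t B) is the trace of B, one diagonal entry at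
  -- a time.
  pencil₁-expand : ∀ {m} (U B : Matrix Carrier (suc m)) → (∀ i j → U i j ≈ δ i j) →
    pencil U B 1 ≈ B zero zero + pencil (minor U zero) (minor B zero) 1
  pencil₁-expand {m} U B U≈I = begin
    pencil U B 1
      ≈⟨ +-cong (*-congˡ (+-cong (*-congʳ (U≈I zero zero))
                  (*-congˡ (pencil₀-identity (minor U zero) (minor B zero) λ i j → U≈I (suc i) (suc j)))))
                (sum-zero {m} λ j →
                  pencilTerm₁-vanish U B (λ i → U≈I (suc i) zero) j (U≈I zero (suc j))) ⟩
    1# * (1# * pencil (minor U zero) (minor B zero) 1 + B zero zero * 1#) + 0#
      ≈⟨ solve 2 (λ p b → con 1 :* (con 1 :* p :+ b :* con 1) :+ con 0 := b :+ p) refl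
           (pencil (minor U zero) (minor B zero) 1) (B zero zero) ⟩
    B zero zero + pencil (minor U zero) (minor B zero) 1 ∎

  -- The coefficient of t ^ 2 in det (I + t B) is the sum of the principal 2 x 2
  -- minors of B.  This splits off the minors that involve index 0, with the
  -- products of off-diagonal entries moved to the left-hand side.
  pencil₂-expand : ∀ {m} (U B : Matrix Carrier (suc m)) → (∀ i j → U i j ≈ δ i j) →
    pencil U B 2 + (sum λ k → B zero (suc k) * B (suc k) zero)
      ≈ pencil (minor U zero) (minor B zero) 2 + B zero zero * pencil (minor U zero) (minor B zero) 1
  pencil₂-expand {m} U B U≈I = begin
    pencil U B 2 + (sum λ k → B zero (suc k) * B (suc k) zero)
      ≈⟨ trans (+-assoc _ _ _) (+-cong (*-congˡ (+-congʳ (*-congʳ (U≈I zero zero))))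
           (trans (sym (∑-distrib-+ {m} _ _)) (sum-zero {m} (cancel {m} U B U≈I)))) ⟩
    1# * (1# * pencil U′ B′ 2 + B zero zero * pencil U′ B′ 1) + 0#
      ≈⟨ solve 2 (λ p b → con 1 :* (con 1 :* p :+ b) :+ con 0 := p :+ b) refl
           (pencil U′ B′ 2) (B zero zero * pencil U′ B′ 1) ⟩
    pencil U′ B′ 2 + B zero zero * pencil U′ B′ 1 ∎
    where
    U′ B′ : Matrix Carrier m
    U′ = minor U zero
    B′ = minor B zero
    -- The sign of column k + 1 and the sign of the cofactor multiply to -1.
    cancel : ∀ {m} (U B : Matrix Carrier (suc m)) → (∀ i j → U i j ≈ δ i j) → ∀ k →
             pencilTerm U B 2 (suc k) + B zero (suc k) * B (suc k) zero ≈ 0#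
    cancel {suc m} U B U≈I k = begin
      pencilTerm U B 2 (suc k) + b * b′
        ≈⟨ +-congʳ (*-congˡ (+-cong (*-zeroˡ (U≈I zero (suc k)))
             (*-congˡ (pencil₁-cofactor (minor U (suc k)) (minor B (suc k)) k
                        (λ i → U≈I (suc i) zero) (λ i l → U≈I (suc i) (suc (punchIn k l))))))) ⟩
      - 1# * s * (0# + b * (s * b′)) + b * b′
        ≈⟨ solve 4 (λ t s b b′ → t :* s :* (con 0 :+ b :* (s :* b′)) :+ b :* b′
                     := (t :* (s :* s) :+ con 1) :* (b :* b′)) refl (- 1#) s b b′ ⟩
      (- 1# * (s * s) + 1#) * (b * b′)  ≈⟨ *-congʳ (+-congʳ (*-congˡ (sign-square (toℕ k)))) ⟩
      (- 1# * 1# + 1#) * (b * b′)       ≈⟨ *-zeroˡ (trans (+-congʳ (*-identityʳ _)) (-‿inverseˡ 1#)) ⟩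
      0#                                ∎
      where
      s b b′ : Carrier
      s  = sign (toℕ k)
      b  = B zero (suc k)
      b′ = B (suc k) zero

  2# : Carrier
  2# = 1# + 1#

  -- The trace of B B is d₁ ² - 2 d₂.  In this form no subtraction is needed.
  pencil-newton : ∀ {m} (U B : Matrix Carrier m) → (∀ i j → U i j ≈ δ i j) →
    traceSquare B + 2# * pencil U B 2 ≈ pencil U B 1 * pencil U B 1
  pencil-newton {zero}  U B U≈I = trans (+-identityˡ _) (trans (zeroʳ _) (sym (zeroˡ _)))
  pencil-newton {suc m} U B U≈I = begin
    traceSquare B + 2# * pencil U B 2
      ≈⟨ +-congʳ (traceSquare-suc B) ⟩
    b * b + s + (s + t) + 2# * pencil U B 2
      ≈⟨ solve 4 (λ b s t p → b :* b :+ s :+ (s :+ t) :+ con 2 :* p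
                      := b :* b :+ t :+ con 2 :* (p :+ s)) refl b s t (pencil U B 2) ⟩
    b * b + t + 2# * (pencil U B 2 + s)
      ≈⟨ +-congˡ (*-congˡ (pencil₂-expand U B U≈I)) ⟩
    b * b + t + 2# * (pencil U′ B′ 2 + b * d)
      ≈⟨ solve 4 (λ b t p d → b :* b :+ t :+ con 2 :* (p :+ b :* d)
                      := b :* b :+ con 2 :* (b :* d) :+ (t :+ con 2 :* p)) refl b t (pencil U′ B′ 2) d ⟩
    b * b + 2# * (b * d) + (t + 2# * pencil U′ B′ 2)
      ≈⟨ +-congˡ (pencil-newton U′ B′ λ i j → U≈I (suc i) (suc j)) ⟩
    b * b + 2# * (b * d) + d * d
      ≈⟨ solve 2 (λ b d → b :* b :+ con 2 :* (b :* d) :+ d :* d := (b :+ d) :* (b :+ d)) refl b d ⟩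
    (b + d) * (b + d)
      ≈⟨ *-cong (pencil₁-expand U B U≈I) (pencil₁-expand U B U≈I) ⟨
    pencil U B 1 * pencil U B 1 ∎
    where
    U′ = minor U zero
    B′ = minor B zero
    b = B zero zero
    s = sum {m} λ k → B zero (suc k) * B (suc k) zero
    t = traceSquare B′
    d = pencil U′ B′ 1

  -- rootProduct ρ k is the coefficient of t ^ k in ∏ (1 - ρ i t), the reversal of
  -- ∏ (X - ρ i).
  rootProduct : ∀ {n} → Vector Carrier n → ℕ → Carrier
  rootProduct {zero}  ρ = one
  rootProduct {suc n} ρ k =
    1# * rootProduct (λ i → ρ (suc i)) k + - ρ zero * shift (rootProduct (λ i → ρ (suc i))) k

  reversal-product : ∀ {n} (ρ : Vector Carrier n) →
                     Reversal n (Σᵖ.product λ i → X P.+ (P.- C (ρ i))) (rootProduct ρ)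
  reversal-product {zero}  ρ = reversal-1
  reversal-product {suc n} ρ =
    reversal-linear-* (linear (+-identityˡ _) refl) (reversal-product (λ i → ρ (suc i)))

  rootProduct₀ : ∀ {n} (ρ : Vector Carrier n) → rootProduct ρ 0 ≈ 1#
  rootProduct₀ {zero}  ρ = refl
  rootProduct₀ {suc n} ρ = trans (+-cong (*-identityˡ _) (zeroʳ _))
    (trans (+-identityʳ _) (rootProduct₀ (λ i → ρ (suc i))))

  neg-* : ∀ x y → - x * - y ≈ x * y
  neg-* x y = begin
    - x * - y                  ≈⟨ *-cong (-1*x≈-x x) (-1*x≈-x y) ⟨
    - 1# * x * (- 1# * y)
      ≈⟨ solve 3 (λ t x y → t :* x :* (t :* y) := t :* t :* (x :* y)) refl (- 1#) x y ⟩
    - 1# * - 1# * (x * y)      ≈⟨ *-congʳ (trans (-1*x≈-x _) (-‿involutive 1#)) ⟩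
    1# * (x * y)               ≈⟨ *-identityˡ _ ⟩
    x * y                      ∎

  rootProduct-newton : ∀ {n} (ρ : Vector Carrier n) →
    (sum λ i → ρ i * ρ i) + 2# * rootProduct ρ 2 ≈ rootProduct ρ 1 * rootProduct ρ 1
  rootProduct-newton {zero}  ρ = trans (+-identityˡ _) (trans (zeroʳ _) (sym (zeroˡ _)))
  rootProduct-newton {suc n} ρ = begin
    ρ zero * ρ zero + p + 2# * (1# * e₂ + b * e₁)
      ≈⟨ +-congʳ (+-congʳ (neg-* _ _)) ⟨
    b * b + p + 2# * (1# * e₂ + b * e₁)
      ≈⟨ solve 4 (λ b p e₂ e₁ → b :* b :+ p :+ con 2 :* (con 1 :* e₂ :+ b :* e₁)
                    := b :* b :+ con 2 :* (b :* e₁) :+ (p :+ con 2 :* e₂)) refl b p e₂ e₁ ⟩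
    b * b + 2# * (b * e₁) + (p + 2# * e₂)
      ≈⟨ +-congˡ (rootProduct-newton ρ′) ⟩
    b * b + 2# * (b * e₁) + e₁ * e₁
      ≈⟨ solve 2 (λ b e → b :* b :+ con 2 :* (b :* e) :+ e :* e
                    := (con 1 :* e :+ b :* con 1) :* (con 1 :* e :+ b :* con 1)) refl b e₁ ⟩
    (1# * e₁ + b * 1#) * (1# * e₁ + b * 1#)
      ≈⟨ *-cong (+-congˡ (*-congˡ (rootProduct₀ ρ′))) (+-congˡ (*-congˡ (rootProduct₀ ρ′))) ⟨
    (1# * e₁ + b * rootProduct ρ′ 0) * (1# * e₁ + b * rootProduct ρ′ 0) ∎
    where
    ρ′ : Vector Carrier n
    ρ′ i = ρ (suc i)
    b = - ρ zero
    p = sum λ i → ρ′ i * ρ′ i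
    e₁ = rootProduct ρ′ 1
    e₂ = rootProduct ρ′ 2

  -- The power sum of the roots of the characteristic polynomial is the trace of
  -- A A.  Both sides satisfy Newton's identity with the same coefficients.
  sum-eigenvalue-squares : ∀ {n} (A : Matrix Carrier n) (ρ : Vector Carrier n) →
    Determinant.det polyRawRing (λ i j → (if does (i ≟ j) then X else P.0#) P.+ (P.- C (A i j)))
      ≈ᵖ (Σᵖ.product λ i → X P.+ (P.- C (ρ i))) →
    sum (λ i → ρ i * ρ i) ≈ traceSquare A
  sum-eigenvalue-squares {n} A ρ char≈ = begin
    sum (λ i → ρ i * ρ i)  ≈⟨ +-cancelʳ (2# * D 2) _ _ newton ⟩
    traceSquare -A         ≈⟨ sum-cong-≋ {n} (λ i → sum-cong-≋ {n} λ j → neg-* (A i j) (A j i)) ⟩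
    traceSquare A          ∎
    where
    -A : Matrix Carrier n
    -A i j = - A i j
    D E : ℕ → Carrier
    D = pencil δ -A
    E = rootProduct ρ
    entry : ∀ i j → Linear ((if does (i ≟ j) then X else P.0#) P.+ (P.- C (A i j))) (- A i j) (δ i j)
    entry i j with does (i ≟ j)
    ... | true  = linear (+-identityˡ _) refl
    ... | false = constant refl refl
    D≈E : ∀ k → D k ≈ E k
    D≈E = reversal-unique (reversal-det entry) (reversal-product ρ) char≈
    newton : sum (λ i → ρ i * ρ i) + 2# * D 2 ≈ traceSquare -A + 2# * D 2
    newton = begin
      sum (λ i → ρ i * ρ i) + 2# * D 2  ≈⟨ +-congˡ (*-congˡ (D≈E 2)) ⟩
      sum (λ i → ρ i * ρ i) + 2# * E 2  ≈⟨ rootProduct-newton ρ ⟩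
      E 1 * E 1                         ≈⟨ *-cong (D≈E 1) (D≈E 1) ⟨
      D 1 * D 1                         ≈⟨ pencil-newton δ -A (λ _ _ → refl) ⟨
      traceSquare -A + 2# * D 2         ∎

-- Order, the Cauchy-Schwarz inequality and square roots in the reals
module RealOrder {c ℓ₁ ℓ₂} (ℝ : Reals c ℓ₁ ℓ₂) where
  open Reals ℝ hiding (zero; sum)
  open CommutativeRing commutativeRing using (semiring; commutativeSemiring)
  open Algebra.Properties.Semiring.Sum semiring
  open Algebra.Solver.Ring.NaturalCoefficients.Default commutativeSemiring
  open Relation.Binary.Reasoning.Setoid setoid
  private
    module < = IsStrictPartialOrder <-isStrictPartialOrder

  <-irrefl : ∀ {x} → ¬ x < x
  <-irrefl = <.irrefl refl

  ≤-resp-≈ : ∀ {x x′ y y′} → x ≈ x′ → y ≈ y′ → x ≤ y → x′ ≤ y′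
  ≤-resp-≈ x≈x′ y≈y′ x≤y y′<x′ = x≤y (<.<-respˡ-≈ (sym y≈y′) (<.<-respʳ-≈ (sym x≈x′) y′<x′))

  ≤-refl : ∀ {x} → x ≤ x
  ≤-refl = <-irrefl

  ≤-trans : ∀ {x y z} → x ≤ y → y ≤ z → x ≤ z
  ≤-trans {x} {y} {z} x≤y y≤z z<x with <-cotrans z<x y
  ... | inj₁ z<y = y≤z z<y
  ... | inj₂ y<x = x≤y y<x

  +-monoʳ-< : ∀ {x y} z → x < y → z + x < z + y
  +-monoʳ-< z x<y = <.<-respˡ-≈ (+-comm _ z) (<.<-respʳ-≈ (+-comm _ z) (+-monoˡ-< z x<y))

  x-y+y≈x : ∀ x y → (x - y) + y ≈ x
  x-y+y≈x x y = trans (+-assoc x _ y) (trans (+-congˡ (-‿inverseˡ y)) (+-identityʳ x))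

  x+y-y≈x : ∀ x y → (x + y) - y ≈ x
  x+y-y≈x x y = trans (+-assoc x y _) (trans (+-congˡ (-‿inverseʳ y)) (+-identityʳ x))

  +-cancelʳ-< : ∀ {x y} z → x + z < y + z → x < y
  +-cancelʳ-< z x+z<y+z =
    <.<-respˡ-≈ (x+y-y≈x _ z) (<.<-respʳ-≈ (x+y-y≈x _ z) (+-monoˡ-< (- z) x+z<y+z))

  +-cancelˡ-< : ∀ {x y} z → z + x < z + y → x < y
  +-cancelˡ-< z z+x<z+y = +-cancelʳ-< z (<.<-respˡ-≈ (+-comm z _) (<.<-respʳ-≈ (+-comm z _) z+x<z+y))

  +-mono-≤ : ∀ {x y u v} → x ≤ y → u ≤ v → x + u ≤ y + v
  +-mono-≤ {x} {y} {u} {v} x≤y u≤v y+v<x+u with <-cotrans y+v<x+u (x + v)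
  ... | inj₁ y+v<x+v = x≤y (+-cancelʳ-< v y+v<x+v)
  ... | inj₂ x+v<x+u = u≤v (+-cancelˡ-< x x+v<x+u)

  <⇒0<- : ∀ {x y} → x < y → 0# < y - x
  <⇒0<- {x} x<y = <.<-respˡ-≈ (-‿inverseʳ x) (+-monoˡ-< (- x) x<y)

  -- If x² < 0, then neither 0 < x nor x < 0 is possible, so x = 0 by tightness of
  -- apartness, which is absurd too.
  0≤x² : ∀ x → 0# ≤ x * x
  0≤x² x x²<0 = <-irrefl (<.<-respˡ-≈ (trans (*-congʳ x≈0) (zeroˡ x)) x²<0)
    where
    0≮x : ¬ 0# < x
    0≮x 0<x = <-irrefl (<-trans (*-pos 0<x 0<x) x²<0)

    0<-x : x < 0# → 0# < - x
    0<-x x<0 = <.<-respʳ-≈ (+-identityˡ _) (<⇒0<- x<0)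

    x≮0 : ¬ x < 0#
    x≮0 x<0 = <-irrefl (<-trans
      (<.<-respʳ-≈ (CharacteristicPolynomial.neg-* commutativeRing x x) (*-pos (0<-x x<0) (0<-x x<0)))
      x²<0)

    x≈0 : x ≈ 0#
    x≈0 = proj₁ (tight x 0#) λ x#0 → [ x≮0 , 0≮x ]′ (Equivalence.to #⇔<⊎> x#0)

  sum-mono-≤ : ∀ {n} {f g : Vector Carrier n} → (∀ i → f i ≤ g i) → sum f ≤ sum g
  sum-mono-≤ {zero}  f≤g = ≤-refl
  sum-mono-≤ {suc n} f≤g = +-mono-≤ (f≤g zero) (sum-mono-≤ (λ i → f≤g (suc i)))

  fromℕ-*-mono-≤ : ∀ k {x y} → x ≤ y → fromℕ k * x ≤ fromℕ k * y
  fromℕ-*-mono-≤ zero    x≤y = ≤-resp-≈ (sym (zeroˡ _)) (sym (zeroˡ _)) ≤-refl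
  fromℕ-*-mono-≤ (suc k) {x} {y} x≤y =
    ≤-resp-≈ (expand x) (expand y) (+-mono-≤ x≤y (fromℕ-*-mono-≤ k x≤y))
    where
    expand : ∀ z → z + fromℕ k * z ≈ fromℕ (suc k) * z
    expand z = solve 2 (λ k z → z :+ k :* z := (con 1 :+ k) :* z) refl (fromℕ k) z

  -- With z = x - y, x² + y² = z² + 2 x y is an identity in z and y.
  2xy≤x²+y² : ∀ x y → x * y + x * y ≤ x * x + y * y
  2xy≤x²+y² x y = ≤-resp-≈ (+-identityˡ _) completeSquare (+-mono-≤ (0≤x² (x - y)) ≤-refl)
    where
    z = x - y
    completeSquare : z * z + (x * y + x * y) ≈ x * x + y * y
    completeSquare = begin
      z * z + (x * y + x * y)
        ≈⟨ +-congˡ (+-cong (*-congʳ (x-y+y≈x x y)) (*-congʳ (x-y+y≈x x y))) ⟨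
      z * z + ((z + y) * y + (z + y) * y)
        ≈⟨ solve 2 (λ z y → z :* z :+ ((z :+ y) :* y :+ (z :+ y) :* y)
                      := (z :+ y) :* (z :+ y) :+ y :* y) refl z y ⟩
      (z + y) * (z + y) + y * y
        ≈⟨ +-congʳ (*-cong (x-y+y≈x x y) (x-y+y≈x x y)) ⟩
      x * x + y * y ∎

  -- The cross terms of the square of a sum, bounded one by one.
  2x∑≤ : ∀ {n} x (y : Vector Carrier n) →
         x * sum y + x * sum y ≤ fromℕ n * (x * x) + sum (λ i → y i * y i)
  2x∑≤ {zero}  x y = ≤-resp-≈ (sym (trans (+-cong (zeroʳ x) (zeroʳ x)) (+-identityʳ 0#)))
    (sym (trans (+-congʳ (zeroˡ _)) (+-identityʳ 0#))) ≤-refl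
  2x∑≤ {suc n} x y = ≤-resp-≈
    (solve 3 (λ x y s → x :* y :+ x :* y :+ (x :* s :+ x :* s) := x :* (y :+ s) :+ x :* (y :+ s))
      refl x (y zero) (sum (λ i → y (suc i))))
    (solve 4 (λ x y k q → x :* x :+ y :* y :+ (k :* (x :* x) :+ q)
                 := (con 1 :+ k) :* (x :* x) :+ (y :* y :+ q))
      refl x (y zero) (fromℕ n) (sum (λ i → y (suc i) * y (suc i))))
    (+-mono-≤ (2xy≤x²+y² x (y zero)) (2x∑≤ x (λ i → y (suc i))))

  cauchySchwarz : ∀ {n} (x : Vector Carrier n) → sum x * sum x ≤ fromℕ n * sum (λ i → x i * x i)
  cauchySchwarz {zero}  x = ≤-resp-≈ (sym (zeroˡ _)) (sym (zeroˡ _)) ≤-refl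
  cauchySchwarz {suc n} x = ≤-resp-≈
    (solve 2 (λ x s → x :* x :+ (x :* s :+ x :* s) :+ s :* s := (x :+ s) :* (x :+ s)) refl x₀ s)
    (solve 3 (λ x k q → x :* x :+ (k :* (x :* x) :+ q) :+ k :* q := (con 1 :+ k) :* (x :* x :+ q))
      refl x₀ (fromℕ n) (sum λ i → x (suc i) * x (suc i)))
    (+-mono-≤ (+-mono-≤ ≤-refl (2x∑≤ x₀ (λ i → x (suc i)))) (cauchySchwarz (λ i → x (suc i))))
    where
    x₀ = x zero
    s  = sum λ i → x (suc i)

  -- A known zero entry need not be counted in the length.
  cauchySchwarz-zero : ∀ {n} (x : Vector Carrier (suc n)) i → x i ≈ 0# →
                       sum x * sum x ≤ fromℕ n * sum (λ j → x j * x j)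
  cauchySchwarz-zero {n} x i xᵢ≈0 =
    ≤-resp-≈ (*-cong drop drop) (*-congˡ drop²) (cauchySchwarz (removeAt x i))
    where
    drop : sum (removeAt x i) ≈ sum x
    drop = sym (trans (sum-remove {i = i} x) (trans (+-congʳ xᵢ≈0) (+-identityˡ _)))
    drop² : sum (λ j → removeAt x i j * removeAt x i j) ≈ sum (λ j → x j * x j)
    drop² = sym (trans (sum-remove {i = i} (λ j → x j * x j))
      (trans (+-congʳ (trans (*-congʳ xᵢ≈0) (zeroˡ _))) (+-identityˡ _)))

  -- Cauchy-Schwarz for each row and then for the row sums.
  cauchySchwarz-hollow : ∀ {n} (M : Matrix Carrier (suc n)) → (∀ i → M i i ≈ 0#) →
    (sum λ i → sum λ j → M i j) * (sum λ i → sum λ j → M i j)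
      ≤ fromℕ (suc n) * (fromℕ n * (sum λ i → sum λ j → M i j * M i j))
  cauchySchwarz-hollow {n} M Mᵢᵢ≈0 = ≤-trans (cauchySchwarz (λ i → sum (M i)))
    (fromℕ-*-mono-≤ (suc n) (≤-resp-≈ refl
      (sym (*-distribˡ-sum {suc n} (fromℕ n) (λ i → sum λ j → M i j * M i j)))
      (sum-mono-≤ λ i → cauchySchwarz-zero (M i) i (Mᵢᵢ≈0 i))))

  -- If √ y < x, then √ y + x is positive, so x² - y = (x + √ y) (x - √ y) is
  -- positive as well.
  ≤-√ : ∀ {x y} → x * x ≤ y → x ≤ √ y
  ≤-√ {x} {y} x²≤y a<x = x²≤y (<.<-respˡ-≈ (√-square 0≤y) a²<x²)
    where
    a = √ y
    0≤y : 0# ≤ y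
    0≤y = ≤-trans (0≤x² x) x²≤y
    0<x+a : 0# < x + a
    0<x+a with <-cotrans a<x 0#
    ... | inj₁ a<0 = contradiction a<0 (√-nonneg 0≤y)
    ... | inj₂ 0<x with <-cotrans 0<x (x + a)
    ... | inj₁ 0<x+a = 0<x+a
    ... | inj₂ x+a<x = contradiction
      (+-cancelˡ-< x (<.<-respʳ-≈ (sym (+-identityʳ x)) x+a<x)) (√-nonneg 0≤y)
    z = x - a
    x² : (x + a) * z + a * a ≈ x * x
    x² = begin
      (x + a) * z + a * a        ≈⟨ +-congʳ (*-congʳ (+-congʳ (x-y+y≈x x a))) ⟨
      (z + a + a) * z + a * a    ≈⟨ solve 2 (λ z a → (z :+ a :+ a) :* z :+ a :* a := (z :+ a) :* (z :+ a)) refl z a ⟩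
      (z + a) * (z + a)          ≈⟨ *-cong (x-y+y≈x x a) (x-y+y≈x x a) ⟩
      x * x                      ∎
    a²<x² : a * a < x * x
    a²<x² = <.<-respˡ-≈ (+-identityˡ _) (<.<-respʳ-≈ x² (+-monoˡ-< (a * a) (*-pos 0<x+a (<⇒0<- a<x))))

  ½+½≈1 : ½ + ½ ≈ 1#
  ½+½≈1 = begin
    ½ + ½
      ≈⟨ solve 1 (λ h → h :+ h := h :* (con 1 :+ (con 1 :+ con 0))) refl ½ ⟩
    ½ * fromℕ 2                ≈⟨ *-congˡ (x-y+y≈x (fromℕ 2) 0#) ⟨
    ½ * ((fromℕ 2 - 0#) + 0#)  ≈⟨ *-congˡ (+-identityʳ _) ⟩
    ½ * (fromℕ 2 - 0#)         ≈⟨ proj₁ (proj₂ (#⇒invertible 2#0)) ⟩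
    1#                         ∎

  ≤-/2 : ∀ {x y} → x + x ≤ y → x ≤ y /2
  ≤-/2 {x} {y} 2x≤y y/2<x = 2x≤y (<.<-respˡ-≈ doubled
    (<-trans (+-monoˡ-< (y /2) y/2<x) (+-monoʳ-< x y/2<x)))
    where
    doubled : y /2 + y /2 ≈ y
    doubled = trans (sym (distribˡ y ½ ½)) (trans (*-congˡ ½+½≈1) (*-identityʳ y))

-- Symmetric Moore-Penrose inverses and the resistance matrix
module ResistanceDistance {c ℓ₁ ℓ₂} (ℝ : Reals c ℓ₁ ℓ₂) where
  open RealMatrices ℝ hiding (zero; sum)
  open RealOrder ℝ
  open CommutativeRing commutativeRing using (semiring; commutativeSemiring)
  open Algebra.Properties.Semiring.Sum semiring

  ⊗-cong : ∀ {n} {A A′ B B′ : Matrix Carrier n} → A ≋ A′ → B ≋ B′ → A ⊗ B ≋ A′ ⊗ B′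
  ⊗-cong {n} A≋A′ B≋B′ i j = sum-cong-≋ {n} λ k → *-cong (A≋A′ i k) (B≋B′ k j)

  ⊗-assoc : ∀ {n} (A B C : Matrix Carrier n) → A ⊗ B ⊗ C ≋ A ⊗ (B ⊗ C)
  ⊗-assoc {n} A B C i j = begin
    sum (λ k → sum (λ l → A i l * B l k) * C k j)
      ≈⟨ sum-cong-≋ {n} (λ k → *-distribʳ-sum {n} (C k j) _) ⟩
    sum (λ k → sum (λ l → A i l * B l k * C k j))
      ≈⟨ ∑-comm {n} {n} _ ⟩
    sum (λ l → sum (λ k → A i l * B l k * C k j))
      ≈⟨ sum-cong-≋ {n} (λ l → sum-cong-≋ {n} λ k → *-assoc _ _ _) ⟩
    sum (λ l → sum (λ k → A i l * (B l k * C k j)))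
      ≈⟨ sum-cong-≋ {n} (λ l → *-distribˡ-sum {n} (A i l) _) ⟨
    sum (λ l → A i l * sum (λ k → B l k * C k j)) ∎
    where open Relation.Binary.Reasoning.Setoid setoid

  transpose-⊗ : ∀ {n} (A B : Matrix Carrier n) → transpose (A ⊗ B) ≋ transpose B ⊗ transpose A
  transpose-⊗ {n} A B i j = sum-cong-≋ {n} λ k → *-comm _ _

  matrixSetoid : ℕ → Setoid _ _
  matrixSetoid n = record
    { Carrier = Matrix Carrier n
    ; _≈_ = _≋_
    ; isEquivalence = record
      { refl  = λ i j → refl
      ; sym   = λ p i j → sym (p i j)
      ; trans = λ p q i j → trans (p i j) (q i j)
      }
    }

  -- With Y the transpose of X, the projections P = A X and Q = X A satisfy
  -- P = Y A and Q = A Y.  They coincide, and then X = Q X = P X = Y P = Y Q = Y.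
  moorePenrose-symmetric : ∀ {n} {A X : Matrix Carrier n} → IsMoorePenroseInverse A X →
                           transpose A ≋ A → X ≋ transpose X
  moorePenrose-symmetric {n} {A} {X} mp Aᵀ≋A = begin
    X              ≈⟨ A†AA†≋A† ⟨
    Q ⊗ X          ≈⟨ ⊗-cong P≋Q reflᴹ ⟨
    P ⊗ X          ≈⟨ ⊗-cong YA≋P reflᴹ ⟨
    Y ⊗ A ⊗ X      ≈⟨ ⊗-assoc Y A X ⟩
    Y ⊗ P          ≈⟨ ⊗-cong (reflᴹ {Y}) P≋Q ⟩
    Y ⊗ Q          ≈⟨ YQ≋Y ⟩
    Y              ∎
    where
    open IsMoorePenroseInverse mp
    open Setoid (matrixSetoid n) using () renaming (refl to reflᴹ; sym to symᴹ)
    open Relation.Binary.Reasoning.Setoid (matrixSetoid n)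
    Y P Q : Matrix Carrier n
    Y = transpose X
    P = A ⊗ X
    Q = X ⊗ A
    YA≋P : Y ⊗ A ≋ P
    YA≋P = begin
      Y ⊗ A            ≈⟨ ⊗-cong (reflᴹ {Y}) Aᵀ≋A ⟨
      Y ⊗ transpose A  ≈⟨ transpose-⊗ A X ⟨
      transpose P      ≈⟨ AA†-symm ⟩
      P                ∎
    AY≋Q : A ⊗ Y ≋ Q
    AY≋Q = begin
      A ⊗ Y            ≈⟨ ⊗-cong Aᵀ≋A (reflᴹ {Y}) ⟨
      transpose A ⊗ Y  ≈⟨ transpose-⊗ X A ⟨
      transpose Q      ≈⟨ A†A-symm ⟩
      Q                ∎
    AP≋A : A ⊗ P ≋ A
    AP≋A = begin
      A ⊗ P                      ≈⟨ ⊗-cong Aᵀ≋A AA†-symm ⟨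
      transpose A ⊗ transpose P  ≈⟨ transpose-⊗ P A ⟨
      transpose (P ⊗ A)          ≈⟨ (λ i j → AA†A≋A j i) ⟩
      transpose A                ≈⟨ Aᵀ≋A ⟩
      A                          ∎
    YQ≋Y : Y ⊗ Q ≋ Y
    YQ≋Y = begin
      Y ⊗ Q              ≈⟨ ⊗-cong (reflᴹ {Y}) A†A-symm ⟨
      Y ⊗ transpose Q    ≈⟨ transpose-⊗ Q X ⟨
      transpose (Q ⊗ X)  ≈⟨ (λ i j → A†AA†≋A† j i) ⟩
      Y                  ∎
    P≋Q : P ≋ Q
    P≋Q = begin
      A ⊗ X              ≈⟨ ⊗-cong AP≋A reflᴹ ⟨
      A ⊗ P ⊗ X          ≈⟨ ⊗-cong (⊗-cong (reflᴹ {A}) YA≋P) reflᴹ ⟨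
      A ⊗ (Y ⊗ A) ⊗ X    ≈⟨ ⊗-cong (⊗-assoc A Y A) reflᴹ ⟨
      A ⊗ Y ⊗ A ⊗ X      ≈⟨ ⊗-cong (⊗-cong AY≋Q reflᴹ) reflᴹ ⟩
      Q ⊗ A ⊗ X          ≈⟨ ⊗-assoc Q A X ⟩
      Q ⊗ P              ≈⟨ ⊗-assoc X A P ⟩
      X ⊗ (A ⊗ P)        ≈⟨ ⊗-cong (reflᴹ {X}) AP≋A ⟩
      Q                  ∎

  laplacian-symmetric : ∀ {n} (G : SimpleGraph n) → transpose (laplacian G) ≋ laplacian G
  laplacian-symmetric G i j = +-cong (degree-symmetric i j) (-‿cong (adjacency-symmetric i j))
    where
    open SimpleGraph G
    degree-symmetric : ∀ i j → degreeMatrix G j i ≈ degreeMatrix G i j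
    degree-symmetric i j with i ≟ j | j ≟ i
    ... | yes ≡.refl | yes _   = refl
    ... | yes i≡j    | no j≢i  = contradiction (≡.sym i≡j) j≢i
    ... | no i≢j     | yes j≡i = contradiction (≡.sym j≡i) i≢j
    ... | no _       | no _    = refl
    adjacency-symmetric : ∀ i j → adjacency G j i ≈ adjacency G i j
    adjacency-symmetric i j with adj? i j | adj? j i
    ... | yes _   | yes _   = refl
    ... | yes i~j | no j≁i  = contradiction (symm i~j) j≁i
    ... | no i≁j  | yes j~i = contradiction (symm j~i) i≁j
    ... | no _    | no _    = refl

  resistance-symmetric : ∀ {n} {L† : Matrix Carrier n} → L† ≋ transpose L† →
                         ∀ i j → resistanceMatrix L† i j ≈ resistanceMatrix L† j i
  resistance-symmetric L†-symm i j = +-cong (+-comm _ _) (-‿cong (*-congˡ (L†-symm i j)))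

  resistance-diagonal : ∀ {n} (L† : Matrix Carrier n) → ∀ i → resistanceMatrix L† i i ≈ 0#
  resistance-diagonal L† i = trans
    (+-congʳ (solve 1 (λ x → x :+ x := (con 1 :+ (con 1 :+ con 0)) :* x) refl (L† i i)))
    (-‿inverseʳ _)
    where open Algebra.Solver.Ring.NaturalCoefficients.Default commutativeSemiring

  -- Every unordered pair occurs twice among the ordered ones, and the diagonal of
  -- the resistance matrix vanishes.
  kirchhoff-double : ∀ {n} {L† : Matrix Carrier n} → L† ≋ transpose L† →
    kirchhoffIndex L† + kirchhoffIndex L† ≈ sum λ i → sum λ j → resistanceMatrix L† i j
  kirchhoff-double {n} {L†} L†-symm = begin
    (sum λ i → sum λ j → upper i j) + (sum λ i → sum λ j → upper i j)
      ≈⟨ +-congˡ (∑-comm {n} {n} upper) ⟩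
    (sum λ i → sum λ j → upper i j) + (sum λ i → sum λ j → upper j i)
      ≈⟨ trans (sum-cong-≋ {n} λ i → ∑-distrib-+ {n} (upper i) (λ j → upper j i))
           (∑-distrib-+ {n} (λ i → sum (upper i)) (λ i → sum λ j → upper j i)) ⟨
    (sum λ i → sum λ j → upper i j + upper j i)
      ≈⟨ sum-cong-≋ {n} (λ i → sum-cong-≋ {n} λ j → split i j) ⟩
    (sum λ i → sum λ j → r i j) ∎
    where
    open Relation.Binary.Reasoning.Setoid setoid
    r upper : Matrix Carrier n
    r = resistanceMatrix L†
    upper i j = if does (i <? j) then r i j else 0#
    upper-< : ∀ {i j} → i Fin.< j → upper i j ≈ r i j
    upper-< {i} {j} i<j = reflexive (≡.cong (if_then r i j else 0#) (dec-true (i <? j) i<j))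
    upper-≮ : ∀ {i j} → ¬ i Fin.< j → upper i j ≈ 0#
    upper-≮ {i} {j} i≮j = reflexive (≡.cong (if_then r i j else 0#) (dec-false (i <? j) i≮j))
    split : ∀ i j → upper i j + upper j i ≈ r i j
    split i j with <-cmp i j
    ... | tri< i<j _ j≮i =
      trans (+-cong (upper-< i<j) (upper-≮ j≮i)) (+-identityʳ _)
    ... | tri> i≮j _ j<i =
      trans (+-cong (upper-≮ i≮j) (upper-< j<i))
        (trans (+-identityˡ _) (resistance-symmetric L†-symm j i))
    ... | tri≈ i≮i ≡.refl _ =
      trans (+-cong (upper-≮ i≮i) (upper-≮ i≮i))
        (trans (+-identityʳ 0#) (sym (resistance-diagonal L† i)))

theorem5p4 : ∀ {c ℓ₁ ℓ₂} (ℝ : Reals c ℓ₁ ℓ₂) →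
    let open RealMatrices ℝ in
    ∀ (n : ℕ) (G : SimpleGraph n) → SimpleGraph.Connected G →
    (L† : Matrix Carrier n) → IsMoorePenroseInverse (laplacian G) L† →
    (ρ : Vector Carrier n) → AreEigenvalues (resistanceMatrix L†) ρ →
    kirchhoffIndex L† ≤
    √ (fromℕ n * (fromℕ n - 1#) * sum (λ i → ρ i * ρ i)) /2
-- A connected graph has a vertex.
theorem5p4 ℝ zero    G (() , _)
theorem5p4 ℝ (suc n) G _ L† mp ρ eigen = ≤-/2 (≤-√ (≤-resp-≈ (*-cong double double) bound
  (cauchySchwarz-hollow r (resistance-diagonal L†))))
  where
  open RealMatrices ℝ hiding (zero)
  open RealOrder ℝ
  open ResistanceDistance ℝ
  open CommutativeRing commutativeRing using (semiring)
  open Algebra.Properties.Semiring.Sum semiring using (sum-cong-≋)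
  open CharacteristicPolynomial commutativeRing using (sum-eigenvalue-squares)
  open Relation.Binary.Reasoning.Setoid setoid
  r : Matrix Carrier (suc n)
  r = resistanceMatrix L†
  L†-symm : L† ≋ transpose L†
  L†-symm = moorePenrose-symmetric mp (laplacian-symmetric G)
  double : (sum λ i → sum λ j → r i j) ≈ kirchhoffIndex L† + kirchhoffIndex L†
  double = sym (kirchhoff-double L†-symm)
  bound : fromℕ (suc n) * (fromℕ n * (sum λ i → sum λ j → r i j * r i j))
          ≈ fromℕ (suc n) * (fromℕ (suc n) - 1#) * sum (λ i → ρ i * ρ i)
  bound = begin
    fromℕ (suc n) * (fromℕ n * (sum λ i → sum λ j → r i j * r i j))
      ≈⟨ *-assoc _ _ _ ⟨
    fromℕ (suc n) * fromℕ n * (sum λ i → sum λ j → r i j * r i j)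
      ≈⟨ *-cong (*-congˡ (trans (+-congʳ (+-comm 1# (fromℕ n))) (x+y-y≈x (fromℕ n) 1#)))
           (trans (sum-eigenvalue-squares r ρ eigen)
             (sum-cong-≋ {suc n} λ i → sum-cong-≋ {suc n} λ j →
               *-congˡ {r i j} (resistance-symmetric L†-symm j i))) ⟨
    fromℕ (suc n) * (fromℕ (suc n) - 1#) * sum (λ i → ρ i * ρ i) ∎
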